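{- Let $X$ be a finite set with $|X|=n\ge 1$. Then the graded poset $\operatorname{Bip}(X)$ of bipartitional relations on $X$, ordered by inclusion, has rank $3n-2$.
   Context: A relation $U\subseteq X\times X$ on a finite set $X$ is bipartitional if both $U$ and $(X\times X)\setminus U$ are transitive. $\operatorname{Bip}(X)$ is the set of bipartitional relations on $X$, partially ordered by inclusion; its minimum is $\emptyset$ and its maximum is $X\times X$. The rank of a graded poset with minimum and maximum is the length (number of cover relations) of any maximal chain. -}

module Defs where

open import Level using (Level; _⊔_; 0ℓ) renaming (suc to lsuc)
open import Data.Empty using (⊥)
open import Data.List.Base using (List; length)
open import Data.List.Relation.Unary.Linked using (Linked)
open import Data.Nat.Base using (ℕ; suc)
open import Data.Product.Base using (_×_; _,_; proj₁; proj₂; ∃-syntax)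
open import Data.Unit.Base using (⊤; tt)
open import Relation.Binary.Bundles using (Poset)
open import Relation.Binary.Core using (Rel; _⇒_; _⇔_)
open import Relation.Binary.Definitions using (Decidable; Transitive; Minimum; Maximum)
open import Relation.Binary.PropositionalEquality.Core using (_≡_)
open import Relation.Nullary.Decidable.Core using (yes; no)
open import Relation.Nullary.Negation.Core using (¬_)
import Data.List.Relation.Binary.Subset.Setoid as Subset
import Relation.Binary.Properties.Poset as PosetProperties

-- The relations are required to be decidable because on a finite set they
-- stand for subsets of X × X; classically this is no restriction.

record BipartitionalRelation {a : Level} (X : Set a) : Set (a ⊔ lsuc 0ℓ) where
  field
    U                : Rel X 0ℓ
    decidable        : Decidable U
    transitive       : Transitive U
    transitive-compl : Transitive (λ x y → ¬ U x y)

open BipartitionalRelation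

-- Equality is mutual inclusion, i.e. equality as subsets of X × X.

Bip : {a : Level} → Set a → Poset (a ⊔ lsuc 0ℓ) a a
Bip X = record
  { Carrier        = BipartitionalRelation X
  ; _≈_            = λ R S → U R ⇔ U S
  ; _≤_            = λ R S → U R ⇒ U S
  ; isPartialOrder = record
    { isPreorder = record
      { isEquivalence = record
        { refl  = (λ r → r) , (λ r → r)
        ; sym   = λ p → proj₂ p , proj₁ p
        ; trans = λ p q → (λ r → proj₁ q (proj₁ p r)) , (λ r → proj₂ p (proj₂ q r))
        }
      ; reflexive = λ p → proj₁ p
      ; trans     = λ p q r → q (p r)
      }
    ; antisym = λ p q → p , q
    }
  }

module _ {a : Level} {X : Set a} where

  ∅-rel : BipartitionalRelation X
  ∅-rel = record
    { U = λ _ _ → ⊥ ; decidable = λ _ _ → no (λ ())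
    ; transitive = λ () ; transitive-compl = λ _ _ () }

  full-rel : BipartitionalRelation X
  full-rel = record
    { U = λ _ _ → ⊤ ; decidable = λ _ _ → yes tt
    ; transitive = λ _ _ → tt ; transitive-compl = λ ¬t _ _ → ¬t tt }

  ∅-minimum : Minimum (Poset._≤_ (Bip X)) ∅-rel
  ∅-minimum _ ()

  full-maximum : Maximum (Poset._≤_ (Bip X)) full-rel
  full-maximum _ _ = tt

module _ {c ℓ₁ ℓ₂ : Level} (P : Poset c ℓ₁ ℓ₂) where

  open Poset P using (Carrier; module Eq)
  open PosetProperties P using (_<_)
  open Subset Eq.setoid using (_⊆_)

  -- A finite chain, given by its elements in increasing order. In a finite
  -- poset every chain is of this form.

  IsChain : List Carrier → Set (c ⊔ ℓ₁ ⊔ ℓ₂)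
  IsChain = Linked _<_

  IsMaximalChain : List Carrier → Set (c ⊔ ℓ₁ ⊔ ℓ₂)
  IsMaximalChain xs = IsChain xs × (∀ ys → IsChain ys → xs ⊆ ys → ys ⊆ xs)

  -- The consecutive pairs of a maximal chain are cover relations, so a maximal
  -- chain consisting of r cover relations has r + 1 elements.

  HasLength : List Carrier → ℕ → Set
  HasLength xs r = length xs ≡ suc r

  -- Meant for finite posets with minimum and maximum, where being graded is the
  -- same as all maximal chains having one common length, which is then the rank.

  IsGradedOfRank : ℕ → Set (c ⊔ ℓ₁ ⊔ ℓ₂)
  IsGradedOfRank r =
    (∃[ xs ] (IsMaximalChain xs × HasLength xs r)) ×
    (∀ xs → IsMaximalChain xs → HasLength xs r)

{-# OPTIONS --safe #-}

-- A bipartitional relation is an ordered partition of X into blocks, each of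
-- which is either full or empty inside. Numbering X by Fin n, let ρ(R) be the
-- number of i that are related to themselves, plus the number of i that are not
-- a non-least element of an empty block, plus the number of i that are a
-- non-least element of a full block. Each of these three sets grows with R, and
-- ρ(Rᶜ) = 3n − ρ(R). Moreover ρ is strictly monotone, with ρ(∅) = 1 and
-- ρ(X × X) = 3n − 1. If R ⊂ S and S is nonempty on an empty block of R, then one
-- may split that block in two, or fill it if it is a singleton, staying inside
-- S; this raises ρ by one. Otherwise the same applies to Sᶜ ⊂ Rᶜ.

module Submission where

open import Defs
open import Data.Empty using (⊥-elim)
open import Data.Fin.Base as Fin using (Fin; zero; suc)
open import Data.Fin.Induction using (<-wellFounded)
import Data.Fin.Properties as Fin
open import Data.List.Base using (List; []; _∷_; length)
open import Data.List.Relation.Unary.All as All using (All)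
import Data.List.Relation.Unary.AllPairs as AllPairs
open import Data.List.Relation.Unary.Any as Any using (here; there)
open import Data.List.Relation.Unary.Linked as Linked using (Linked; []; [-]; _∷_)
open import Data.List.Relation.Unary.Linked.Properties using (Linked⇒AllPairs)
open import Data.Nat.Base using (ℕ; zero; suc; _+_; _*_; _∸_; _≤_; _<_; _≥_; z≤n; s≤s)
open import Data.Nat.Properties
open import Data.Nat.Tactic.RingSolver using (solve-∀)
open import Data.Product.Base using (_×_; _,_; proj₁; proj₂; ∃-syntax)
open import Data.Sum.Base using (_⊎_; inj₁; inj₂)
open import Function.Base using (_∘_)
open import Function.Bundles using (_↔_; Inverse)
open import Induction.WellFounded using (Acc; acc)
open import Level using (Level; 0ℓ)
open import Relation.Binary.Bundles using (Poset)
open import Relation.Binary.Core using (_⇒_)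
open import Relation.Binary.Definitions using (Minimum; Maximum; tri<; tri≈; tri>)
open import Relation.Binary.PropositionalEquality
import Relation.Binary.Properties.Poset as PosetProperties
open import Relation.Nullary using (¬_; Dec; yes; no; contradiction; ¬?; _×-dec_; _⊎-dec_)
open import Relation.Nullary.Decidable using (decidable-stable)
open import Relation.Unary using (Pred; Decidable)

-- Gradedness from a rank function

module RankFunction {c ℓ₁ ℓ₂} (P : Poset c ℓ₁ ℓ₂) (ρ : Poset.Carrier P → ℕ)
  (ρ-mono : ∀ {x y} → Poset._≤_ P x y → ρ x ≤ ρ y)
  (ρ-strict : ∀ {x y} → PosetProperties._<_ P x y → ρ x < ρ y)
  (interpolate : ∀ {x y} → PosetProperties._<_ P x y → 2 + ρ x ≤ ρ y →
                 ∃[ z ] (PosetProperties._<_ P x z × PosetProperties._<_ P z y))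
  (0# 1# : Poset.Carrier P)
  (minimum : Minimum (Poset._≤_ P) 0#) (maximum : Maximum (Poset._≤_ P) 1#)
  where

  open Poset P using (Carrier; _≈_; module Eq)
  open PosetProperties P using (≤∧≉⇒<) renaming (_<_ to _≺_; <-trans to ≺-trans; <-irrefl to ≺-irrefl)
  open import Data.List.Membership.Setoid Eq.setoid using (_∈_)
  import Data.List.Relation.Binary.Subset.Setoid Eq.setoid as Sub

  ρ-cong : ∀ {x y} → x ≈ y → ρ x ≡ ρ y
  ρ-cong x≈y = ≤-antisym (ρ-mono (Poset.reflexive P x≈y)) (ρ-mono (Poset.reflexive P (Eq.sym x≈y)))

  minimum-strict : ∀ {x} → ρ 0# ≢ ρ x → 0# ≺ x
  minimum-strict ≢ = ≤∧≉⇒< (minimum _) (≢ ∘ ρ-cong)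

  maximum-strict : ∀ {x} → ρ x ≢ ρ 1# → x ≺ 1#
  maximum-strict ≢ = ≤∧≉⇒< (maximum _) (≢ ∘ ρ-cong)

  above : ∀ {x y xs} → Linked _≺_ (x ∷ xs) → y ∈ xs → ρ x < ρ y
  above chain y∈ = go (AllPairs.head (Linked⇒AllPairs ≺-trans chain)) y∈
    where
    go : ∀ {x y xs} → All (x ≺_) xs → y ∈ xs → ρ x < ρ y
    go (x≺ All.∷ _)  (here y≈) = <-≤-trans (ρ-strict x≺) (≤-reflexive (sym (ρ-cong y≈)))
    go (_ All.∷ x≺s) (there y∈) = go x≺s y∈

  same-rank : ∀ {x y xs} → Linked _≺_ xs → x ∈ xs → y ∈ xs → ρ x ≡ ρ y → x ≈ y
  same-rank chain (here x≈) (here y≈) eq = Eq.trans x≈ (Eq.sym y≈)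
  same-rank chain (here x≈) (there y∈) eq =
    contradiction (trans (sym (ρ-cong x≈)) eq) (<⇒≢ (above chain y∈))
  same-rank chain (there x∈) (here y≈) eq =
    contradiction (trans (sym (ρ-cong y≈)) (sym eq)) (<⇒≢ (above chain x∈))
  same-rank chain (there x∈) (there y∈) eq = same-rank (Linked.tail chain) x∈ y∈ eq

  -- Interpolation lowers the upper end until the gap is one; `k` bounds its rank and is the
  -- recursion measure.
  successor : ∀ {x y} → x ≺ y → ∃[ z ] (x ≺ z × ρ z ≡ suc (ρ x))
  successor {y = y} x≺y = go (ρ y) x≺y ≤-refl
    where
    go : ∀ k {x y} → x ≺ y → ρ y ≤ k → ∃[ z ] (x ≺ z × ρ z ≡ suc (ρ x))
    go zero x≺y y≤ = contradiction (<-≤-trans (ρ-strict x≺y) y≤) λ ()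
    go (suc k) {x} {y} x≺y y≤ with m≤n⇒m<n∨m≡n (ρ-strict x≺y)
    ... | inj₂ eq  = y , x≺y , sym eq
    ... | inj₁ gap =
      let z , x≺z , z≺y = interpolate x≺y gap
      in go k x≺z (≤-pred (<-≤-trans (ρ-strict z≺y) y≤))

  -- The chain climbs one rank at a time. The last component, that no rank is skipped, is what later
  -- makes the chain maximal.
  saturated : ∀ k x → k + ρ x ≡ ρ 1# →
    ∃[ xs ] (Linked _≺_ (x ∷ xs) × length xs ≡ k ×
             (∀ m → ρ x ≤ m → m ≤ ρ 1# → ∃[ z ] (z ∈ x ∷ xs × ρ z ≡ m)))
  saturated zero x eq =
    [] , [-] , refl , λ m x≤m m≤ →
      x , here Eq.refl , ≤-antisym x≤m (≤-trans m≤ (≤-reflexive (sym eq)))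
  saturated (suc k) x eq with successor (maximum-strict {x} (<⇒≢ (≤-trans (s≤s (m≤n+m (ρ x) k)) (≤-reflexive eq))))
  ... | y , x≺y , ρy with saturated k y (trans (cong (k +_) ρy) (trans (+-suc k (ρ x)) eq))
  ... | xs , chain , len , hit = y ∷ xs , x≺y ∷ chain , cong suc len , hit′
    where
    hit′ : ∀ m → ρ x ≤ m → m ≤ ρ 1# → ∃[ z ] (z ∈ x ∷ y ∷ xs × ρ z ≡ m)
    hit′ m x≤m m≤ with m≤n⇒m<n∨m≡n x≤m
    ... | inj₂ eq = x , here Eq.refl , eq
    ... | inj₁ x<m =
      let z , z∈ , ρz = hit m (≤-trans (≤-reflexive ρy) x<m) m≤ in z , there z∈ , ρz

  -- Maximality among chains that start at `x`. Fixing the start lets the property pass to tails,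
  -- since nothing may be inserted below.
  Unrefinable : Carrier → List Carrier → Set _
  Unrefinable x xs = ∀ ys → Linked _≺_ (x ∷ ys) → xs Sub.⊆ ys → ys Sub.⊆ xs

  -- An end below `1#` could be extended and a rank jump of two or more could be interpolated, so
  -- every link raises `ρ` by exactly one.
  unrefinable-length : ∀ x xs → Linked _≺_ (x ∷ xs) → Unrefinable x xs → length xs + ρ x ≡ ρ 1#
  unrefinable-length x [] _ max with ρ x ≟ ρ 1#
  ... | yes eq = eq
  ... | no ≢ = contradiction (max (1# ∷ []) (maximum-strict ≢ ∷ [-]) (λ ()) (here Eq.refl)) λ ()
  unrefinable-length x (y ∷ xs) (x≺y ∷ chain) max with m≤n⇒m<n∨m≡n (ρ-strict x≺y)
  ... | inj₁ gap =
    let z , x≺z , z≺y = interpolate x≺y gap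
    in ⊥-elim (between z z≺y (max (z ∷ y ∷ xs) (x≺z ∷ z≺y ∷ chain) there (here Eq.refl)))
    where
    between : ∀ z → z ≺ y → ¬ (z ∈ y ∷ xs)
    between z z≺y (here z≈y) = ≺-irrefl z≈y z≺y
    between z z≺y (there z∈) = <-asym (ρ-strict z≺y) (above chain z∈)
  ... | inj₂ eq = begin
    suc (length xs) + ρ x ≡⟨ sym (+-suc (length xs) (ρ x)) ⟩
    length xs + suc (ρ x) ≡⟨ cong (length xs +_) eq ⟩
    length xs + ρ y       ≡⟨ unrefinable-length y xs chain max′ ⟩
    ρ 1#                  ∎
    where
    open ≡-Reasoning
    max′ : Unrefinable y xs
    max′ ys chain′ xs⊆ys {z} z∈ys with max (y ∷ ys) (x≺y ∷ chain′)
           (λ { (here z≈y) → here z≈y ; (there z∈) → there (xs⊆ys z∈) }) (there z∈ys)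
    ... | here z≈y = contradiction (sym (ρ-cong z≈y)) (<⇒≢ (above chain′ z∈ys))
    ... | there z∈ = z∈

  isGradedOfRank : ∀ r → r + ρ 0# ≡ ρ 1# → IsGradedOfRank P r
  isGradedOfRank r eq = existence , uniqueness
    where
    existence : ∃[ xs ] (IsMaximalChain P xs × HasLength P xs r)
    existence with saturated r 0# eq
    ... | xs , chain , len , hit = 0# ∷ xs , (chain , maximal) , cong suc len
      where
      maximal : ∀ ys → Linked _≺_ ys → (0# ∷ xs) Sub.⊆ ys → ys Sub.⊆ (0# ∷ xs)
      maximal ys chain′ xs⊆ys {y} y∈ =
        -- Some `z` of the saturated chain has the rank of `y`. Both lie in the chain `ys`, where a
        -- rank determines the element.
        let z , z∈ , ρz = hit (ρ y) (ρ-mono (minimum y)) (ρ-mono (maximum y))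
        in Any.map (Eq.trans (same-rank chain′ y∈ (xs⊆ys z∈) (sym ρz))) z∈

    uniqueness : ∀ xs → IsMaximalChain P xs → HasLength P xs r
    uniqueness [] (_ , max) = contradiction (max (0# ∷ []) [-] (λ ()) (here Eq.refl)) λ ()
    uniqueness (x ∷ xs) (chain , max) with ρ 0# ≟ ρ x
    ... | yes ρ0≡ρx = cong suc (+-cancelʳ-≡ (ρ x) (length xs) r (begin
      length xs + ρ x ≡⟨ unrefinable-length x xs chain max′ ⟩
      ρ 1#            ≡⟨ sym eq ⟩
      r + ρ 0#        ≡⟨ cong (r +_) ρ0≡ρx ⟩
      r + ρ x         ∎))
      where
      open ≡-Reasoning
      max′ : Unrefinable x xs
      max′ ys chain′ xs⊆ys {z} z∈ys with max (x ∷ ys) chain′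
             (λ { (here z≈x) → here z≈x ; (there z∈) → there (xs⊆ys z∈) }) (there z∈ys)
      ... | here z≈x = contradiction (sym (ρ-cong z≈x)) (<⇒≢ (above chain′ z∈ys))
      ... | there z∈ = z∈
    -- `0#` could be put in front of a chain that starts at a higher rank.
    ... | no ≢ = ⊥-elim (outside (max (0# ∷ x ∷ xs) (0≺x ∷ chain) there (here Eq.refl)))
      where
      0≺x : 0# ≺ x
      0≺x = minimum-strict ≢
      outside : ¬ (0# ∈ x ∷ xs)
      outside (here 0≈x) = ≺-irrefl 0≈x 0≺x
      outside (there 0∈) = <-asym (ρ-strict 0≺x) (above chain 0∈)

-- Counting the elements of a decidable subset of Fin n

count : ∀ {n} {P : Pred (Fin n) 0ℓ} → Decidable P → ℕ
count {zero}  P? = 0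
count {suc n} P? with P? zero
... | yes _ = suc (count (P? ∘ suc))
... | no  _ = count (P? ∘ suc)

count-mono : ∀ {n} {P Q : Pred (Fin n) 0ℓ} (P? : Decidable P) (Q? : Decidable Q) →
             (∀ i → P i → Q i) → count P? ≤ count Q?
count-mono {zero}  P? Q? P⊆Q = z≤n
count-mono {suc n} P? Q? P⊆Q with P? zero | Q? zero
... | yes _ | yes _ = s≤s (count-mono (P? ∘ suc) (Q? ∘ suc) (P⊆Q ∘ suc))
... | yes p | no ¬q = contradiction (P⊆Q zero p) ¬q
... | no _  | yes _ = m≤n⇒m≤1+n (count-mono (P? ∘ suc) (Q? ∘ suc) (P⊆Q ∘ suc))
... | no _  | no _  = count-mono (P? ∘ suc) (Q? ∘ suc) (P⊆Q ∘ suc)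

count-strict : ∀ {n} {P Q : Pred (Fin n) 0ℓ} (P? : Decidable P) (Q? : Decidable Q) →
               (∀ i → P i → Q i) → ∃[ i ] (Q i × ¬ P i) → count P? < count Q?
count-strict {suc n} P? Q? P⊆Q w with P? zero | Q? zero
... | yes p | no ¬q = contradiction (P⊆Q zero p) ¬q
... | no _  | yes _ = s≤s (count-mono (P? ∘ suc) (Q? ∘ suc) (P⊆Q ∘ suc))
count-strict P? Q? P⊆Q (zero  , q , ¬p) | yes p | yes _ = contradiction p ¬p
count-strict P? Q? P⊆Q (suc i , q , ¬p) | yes _ | yes _ =
  s≤s (count-strict (P? ∘ suc) (Q? ∘ suc) (P⊆Q ∘ suc) (i , q , ¬p))
count-strict P? Q? P⊆Q (zero  , q , ¬p) | no _ | no ¬q = contradiction q ¬q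
count-strict P? Q? P⊆Q (suc i , q , ¬p) | no _ | no _ =
  count-strict (P? ∘ suc) (Q? ∘ suc) (P⊆Q ∘ suc) (i , q , ¬p)

count-≤-suc : ∀ {n} {P Q : Pred (Fin n) 0ℓ} (P? : Decidable P) (Q? : Decidable Q) →
              (∀ i j → Q i → ¬ P i → Q j → ¬ P j → i ≡ j) → count Q? ≤ suc (count P?)
count-≤-suc {zero}  P? Q? uniq = z≤n
count-≤-suc {suc n} P? Q? uniq with P? zero | Q? zero
-- The one allowed element of `Q` outside `P` is spent at `zero`, so `Q` lies in `P` from there on.
... | no ¬p | yes q = s≤s (count-mono (Q? ∘ suc) (P? ∘ suc) λ i qi →
  decidable-stable (P? (suc i)) λ ¬pi → contradiction (uniq zero (suc i) q ¬p qi ¬pi) λ ())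
... | yes _ | yes _ = s≤s (count-≤-suc (P? ∘ suc) (Q? ∘ suc)
  λ i j a b c d → Fin.suc-injective (uniq (suc i) (suc j) a b c d))
... | yes _ | no _ = m≤n⇒m≤1+n (count-≤-suc (P? ∘ suc) (Q? ∘ suc)
  λ i j a b c d → Fin.suc-injective (uniq (suc i) (suc j) a b c d))
... | no _  | no _ = count-≤-suc (P? ∘ suc) (Q? ∘ suc)
  λ i j a b c d → Fin.suc-injective (uniq (suc i) (suc j) a b c d)

count-complement : ∀ {n} {P : Pred (Fin n) 0ℓ} (P? : Decidable P) →
                   count P? + count (λ i → ¬? (P? i)) ≡ n
count-complement {zero}  P? = refl
count-complement {suc n} P? with P? zero
... | yes _ = cong suc (count-complement (P? ∘ suc))
... | no  _ = trans (+-suc _ _) (cong suc (count-complement (P? ∘ suc)))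

count-none : ∀ {n} {P : Pred (Fin n) 0ℓ} (P? : Decidable P) → (∀ i → ¬ P i) → count P? ≡ 0
count-none {zero}  P? ¬P = refl
count-none {suc n} P? ¬P with P? zero
... | yes p = contradiction p (¬P zero)
... | no  _ = count-none (P? ∘ suc) (¬P ∘ suc)

count-zero-only : ∀ {n} {P : Pred (Fin (suc n)) 0ℓ} (P? : Decidable P) →
                  P zero → (∀ i → ¬ P (suc i)) → count P? ≡ 1
count-zero-only P? p ¬P with P? zero
... | yes _ = cong suc (count-none (P? ∘ suc) ¬P)
... | no ¬p = contradiction p ¬p

-- Bipartitional relations

open BipartitionalRelation

module _ {a : Level} {X : Set a} where

  -- Reverses inclusion and swaps full with empty blocks, so that facts about empty blocks carry
  -- over to full ones.
  complement : BipartitionalRelation X → BipartitionalRelation X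
  complement R = record
    { U = λ x y → ¬ U R x y
    ; decidable = λ x y → ¬? (decidable R x y)
    ; transitive = transitive-compl R
    ; transitive-compl = λ ¬¬xy ¬¬yz ¬xz → ¬¬xy λ xy → ¬¬yz λ yz → ¬xz (transitive R xy yz)
    }

  stable : (R : BipartitionalRelation X) → ∀ {x y} → ¬ ¬ U R x y → U R x y
  stable R = decidable-stable (decidable R _ _)

  -- Two elements are loose if they lie in a common empty block.

  Loose : BipartitionalRelation X → X → X → Set
  Loose R x y = ¬ U R x y × ¬ U R y x

  loose? : (R : BipartitionalRelation X) (x y : X) → Dec (Loose R x y)
  loose? R x y = ¬? (decidable R x y) ×-dec ¬? (decidable R y x)

  module _ (R : BipartitionalRelation X) where

    loose-sym : ∀ {x y} → Loose R x y → Loose R y x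
    loose-sym (xy , yx) = yx , xy

    loose-trans : ∀ {x y z} → Loose R x y → Loose R y z → Loose R x z
    loose-trans (xy , yx) (yz , zy) = transitive-compl R xy yz , transitive-compl R zy yx

    U-loose : ∀ {x y z} → U R x y → Loose R y z → U R x z
    U-loose xy (_ , ¬zy) = stable R λ ¬xz → transitive-compl R ¬xz ¬zy xy

    loose-U : ∀ {x y z} → Loose R x y → U R y z → U R x z
    loose-U (_ , ¬yx) yz = stable R λ ¬xz → transitive-compl R ¬yx ¬xz yz

  loose-antitone : ∀ {R S : BipartitionalRelation X} → U R ⇒ U S →
                   ∀ {x y} → Loose S x y → Loose R x y
  loose-antitone R≤S (¬xy , ¬yx) = ¬xy ∘ R≤S , ¬yx ∘ R≤S

  -- Within every empty block, the part in `D` is put before the rest, and both halves stay empty.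
  -- Later uses take `D` inside a single block, so that only this one is split.
  splitBlock : (R : BipartitionalRelation X) {D : Pred X 0ℓ} → Decidable D →
               BipartitionalRelation X
  splitBlock R {D} D? = record
    { U = V
    ; decidable = λ x y → decidable R x y ⊎-dec (loose? R x y ×-dec (D? x ×-dec ¬? (D? y)))
    ; transitive = V-trans
    ; transitive-compl = V-compl
    }
    where
    V : X → X → Set
    V x y = U R x y ⊎ (Loose R x y × D x × ¬ D y)

    V-trans : ∀ {x y z} → V x y → V y z → V x z
    V-trans (inj₁ xy) (inj₁ yz) = inj₁ (transitive R xy yz)
    V-trans (inj₁ xy) (inj₂ (yz , _)) = inj₁ (U-loose R xy yz)
    V-trans (inj₂ (xy , _)) (inj₁ yz) = inj₁ (loose-U R xy yz)
    V-trans (inj₂ (_ , _ , ¬dy)) (inj₂ (_ , dy , _)) = contradiction dy ¬dy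

    V-compl : ∀ {x y z} → ¬ V x y → ¬ V y z → ¬ V x z
    V-compl ¬xy ¬yz (inj₁ xz) = transitive-compl R (¬xy ∘ inj₁) (¬yz ∘ inj₁) xz
    -- The missing pairs put `y` into the empty block of `x` and `z`; on either side of `D` it then
    -- forms a pair of `V`.
    V-compl {x} {y} {z} ¬xy ¬yz (inj₂ ((¬xz , ¬zx) , dx , ¬dz)) with D? y
    ... | yes dy = ¬yz (inj₂ ((¬yz ∘ inj₁ , transitive-compl R ¬zx (¬xy ∘ inj₁)) , dy , ¬dz))
    ... | no ¬dy = ¬xy (inj₂ ((¬xy ∘ inj₁ , transitive-compl R (¬yz ∘ inj₁) ¬zx) , dx , ¬dy))

-- A larger empty block would not do: for another `w` in it, the pairs of `y` with `w` would stay
-- outside the relation while `(y , y)` enters it. `X` lies in `Set` because `V` mentions equality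
-- on `X` and must have level zero.
fillSingleton : {X : Set} (R : BipartitionalRelation X) (y : X) → (∀ x → Dec (x ≡ y)) →
                (∀ x → Loose R x y → x ≡ y) → BipartitionalRelation X
fillSingleton {X} R y _≟y singleton = record
  { U = V
  ; decidable = λ x z → decidable R x z ⊎-dec ((x ≟y) ×-dec (z ≟y))
  ; transitive = V-trans
  ; transitive-compl = V-compl
  }
  where
  V : X → X → Set
  V x z = U R x z ⊎ (x ≡ y × z ≡ y)

  V-trans : ∀ {x w z} → V x w → V w z → V x z
  V-trans (inj₁ xw) (inj₁ wz) = inj₁ (transitive R xw wz)
  V-trans (inj₁ xw) (inj₂ (refl , refl)) = inj₁ xw
  V-trans (inj₂ (refl , refl)) wz = wz

  V-compl : ∀ {x w z} → ¬ V x w → ¬ V w z → ¬ V x z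
  V-compl ¬xw ¬wz (inj₁ xz) = transitive-compl R (¬xw ∘ inj₁) (¬wz ∘ inj₁) xz
  V-compl ¬yw ¬wy (inj₂ (refl , refl)) =
    ¬wy (inj₂ (singleton _ (¬wy ∘ inj₁ , ¬yw ∘ inj₁) , refl))

-- The rank of a relation on Fin n

module _ {n : ℕ} where

  private B = BipartitionalRelation (Fin n)

  Trailing : B → Pred (Fin n) 0ℓ
  Trailing R i = ∃[ j ] (j Fin.< i × Loose R i j)

  trailing? : (R : B) → Decidable (Trailing R)
  trailing? R i = Fin.any? λ j → (j Fin.<? i) ×-dec loose? R i j

  trailing-antitone : ∀ {R S : B} → U R ⇒ U S → ∀ i → Trailing S i → Trailing R i
  trailing-antitone {R} {S} R≤S i (j , j<i , l) = j , j<i , loose-antitone {R = R} {S} R≤S l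

  Reflexive : B → Pred (Fin n) 0ℓ
  Reflexive R i = U R i i

  reflexive? : (R : B) → Decidable (Reflexive R)
  reflexive? R i = decidable R i i

  Leading : B → Pred (Fin n) 0ℓ
  Leading R i = ¬ Trailing R i

  leading? : (R : B) → Decidable (Leading R)
  leading? R i = ¬? (trailing? R i)

  -- This equals three times the number of reflexive elements, plus the number of empty blocks,
  -- minus the number of full blocks, arranged so that each summand is monotone.
  ρ : B → ℕ
  ρ R = count (reflexive? R) + (count (leading? R) + count (trailing? (complement R)))

  module _ {R S : B} (R≤S : U R ⇒ U S) where

    leading-monotone : ∀ i → Leading R i → Leading S i
    leading-monotone i = _∘ trailing-antitone {R} {S} R≤S i

    trailing-complement-monotone : ∀ i → Trailing (complement R) i → Trailing (complement S) i
    trailing-complement-monotone = trailing-antitone {complement S} {complement R} (_∘ R≤S)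

    count-reflexive-mono : count (reflexive? R) ≤ count (reflexive? S)
    count-reflexive-mono = count-mono (reflexive? R) (reflexive? S) λ _ → R≤S

    count-leading-mono : count (leading? R) ≤ count (leading? S)
    count-leading-mono = count-mono (leading? R) (leading? S) leading-monotone

    count-trailing-complement-mono : count (trailing? (complement R)) ≤ count (trailing? (complement S))
    count-trailing-complement-mono = count-mono (trailing? (complement R)) (trailing? (complement S))
      trailing-complement-monotone

  ρ-mono : ∀ {R S : B} → U R ⇒ U S → ρ R ≤ ρ S
  ρ-mono {R} {S} R≤S = +-mono-≤ (count-reflexive-mono {R} {S} R≤S)
    (+-mono-≤ (count-leading-mono {R} {S} R≤S) (count-trailing-complement-mono {R} {S} R≤S))

  -- Each count for `R` pairs with a count for `complement R` over the complementary set, leading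
  -- against trailing, so each pair adds up to `n`.
  ρ-complement : ∀ R → ρ R + ρ (complement R) ≡ 3 * n
  ρ-complement R = begin
    (d + (e + f)) + (d′ + (f′ + g)) ≡⟨ cong (λ g → (d + (e + f)) + (d′ + (f′ + g))) g≡e′ ⟩
    (d + (e + f)) + (d′ + (f′ + e′)) ≡⟨ rearrange d d′ e e′ f f′ ⟩
    (d + d′) + ((e′ + e) + ((f + f′) + 0))
      ≡⟨ cong₂ _+_ (count-complement (reflexive? R))
          (cong₂ _+_ (count-complement (trailing? R))
            (cong (_+ 0) (count-complement (trailing? (complement R))))) ⟩
    3 * n ∎
    where
    open ≡-Reasoning
    d  = count (reflexive? R)
    d′ = count (reflexive? (complement R))
    e  = count (leading? R)
    e′ = count (trailing? R)
    f  = count (trailing? (complement R))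
    f′ = count (leading? (complement R))
    g  = count (trailing? (complement (complement R)))
    rearrange : ∀ d d′ e e′ f f′ →
      (d + (e + f)) + (d′ + (f′ + e′)) ≡ (d + d′) + ((e′ + e) + ((f + f′) + 0))
    rearrange = solve-∀
    g≡e′ : g ≡ e′
    g≡e′ = ≤-antisym
      (count-mono (trailing? (complement (complement R))) (trailing? R)
        (trailing-antitone {R} {complement (complement R)} λ r ¬r → ¬r r))
      (count-mono (trailing? R) (trailing? (complement (complement R)))
        (trailing-antitone {complement (complement R)} {R} (stable R)))

  -- If every trailing element of R is trailing in S, then descending along
  -- looseness in S shows that no empty block of R is broken up in S.

  new-leader : ∀ {R S : B} → U R ⇒ U S → (∀ i → U S i i → U R i i) →
               ∀ {x y} → Loose R x y → U S x y → ∃[ i ] (Leading S i × Trailing R i)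
  new-leader {R} {S} R≤S diagonal {x} {y} lxy Sxy
    with Fin.any? (λ i → leading? S i ×-dec trailing? R i)
  ... | yes found = found
  ... | no none = contradiction Sxy (proj₁ (loose-S x y lxy))
    where
    trailing-S : ∀ i → Trailing R i → Trailing S i
    trailing-S i tR = decidable-stable (trailing? S i) λ ¬tS → none (i , ¬tS , tR)

    descend : ∀ {x y} → Acc Fin._<_ x → y Fin.< x → Loose R x y → Loose S x y
    descend {x} {y} (acc rec) y<x l with trailing-S x (y , y<x , l)
    -- Both `j` and `y` lie below `x`, so the larger of the two is a smaller starting point for the
    -- recursion.
    ... | j , j<x , lxj = loose-trans S lxj (ljy (Fin.<-cmp j y))
      where
      l′ : Loose R j y
      l′ = loose-trans R (loose-sym R (loose-antitone {R = R} {S} R≤S lxj)) l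
      ljy : _ → Loose S j y
      ljy (tri< j<y _ _) = loose-sym S (descend (rec y<x) j<y (loose-sym R l′))
      ljy (tri≈ _ refl _) = loose-trans S (loose-sym S lxj) lxj
      ljy (tri> _ _ y<j) = descend (rec j<x) y<j l′

    loose-S : ∀ x y → Loose R x y → Loose S x y
    loose-S x y l with Fin.<-cmp x y
    ... | tri< x<y _ _ = loose-sym S (descend (<-wellFounded y) x<y (loose-sym R l))
    ... | tri≈ _ refl _ = proj₁ l ∘ diagonal x , proj₁ l ∘ diagonal x
    ... | tri> _ _ y<x = descend (<-wellFounded x) y<x l

  -- The first count grows if a diagonal pair is new; otherwise the second does if `x` and `y` are
  -- loose in `R`, whose empty block breaks up; otherwise the third does, by the same argument for
  -- the complements.
  ρ-strict : ∀ {R S : B} → U R ⇒ U S → ∀ {x y} → U S x y → ¬ U R x y → ρ R < ρ S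
  ρ-strict {R} {S} R≤S {x} {y} Sxy ¬Rxy
    with Fin.any? (λ i → decidable S i i ×-dec ¬? (decidable R i i))
  ... | yes new = +-mono-<-≤ (count-strict (reflexive? R) (reflexive? S) (λ _ → R≤S) new)
    (+-mono-≤ (count-leading-mono {R} {S} R≤S) (count-trailing-complement-mono {R} {S} R≤S))
  ... | no none with decidable R y x
  ... | no ¬Ryx =
    let i , ¬tS , tR = new-leader {R} {S} R≤S diagonal (¬Rxy , ¬Ryx) Sxy
    in +-mono-≤-< (count-reflexive-mono {R} {S} R≤S)
      (+-mono-<-≤
        (count-strict (leading? R) (leading? S) (leading-monotone {R} {S} R≤S)
          (i , ¬tS , λ ¬tR → ¬tR tR))
        (count-trailing-complement-mono {R} {S} R≤S))
    where
    diagonal : ∀ i → U S i i → U R i i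
    diagonal i Sii = stable R λ ¬Rii → none (i , Sii , ¬Rii)
  ... | yes Ryx =
    let i , ¬tR , tS = new-leader {complement S} {complement R} (_∘ R≤S) diagonal
                         ((λ ¬S → ¬S Sxy) , (λ ¬S → ¬S (R≤S Ryx))) ¬Rxy
    in +-mono-≤-< (count-reflexive-mono {R} {S} R≤S)
      (+-mono-≤-< (count-leading-mono {R} {S} R≤S)
        (count-strict (trailing? (complement R)) (trailing? (complement S))
          (trailing-complement-monotone {R} {S} R≤S) (i , tS , ¬tR)))
    where
    diagonal : ∀ i → ¬ U R i i → ¬ U S i i
    diagonal i ¬Rii Sii = none (i , Sii , ¬Rii)

  -- Only the count of leaders can grow, and `D-loose`, which keeps `D` inside one empty block,
  -- leaves room for one new leader.
  ρ-splitBlock : (R : B) {D : Pred (Fin n) 0ℓ} (D? : Decidable D) →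
                 (∀ {i j} → D i → D j → Loose R i j) → ρ (splitBlock R D?) ≤ suc (ρ R)
  ρ-splitBlock R {D} D? D-loose = subst (ρ T ≤_) (+-suc _ _) (+-mono-≤
    (count-mono (reflexive? T) (reflexive? R) reflexive-R)
    (+-mono-≤
      (count-≤-suc (leading? R) (leading? T) λ i j ¬tTi ¬¬tRi ¬tTj ¬¬tRj →
        unique ¬tTi (decidable-stable (trailing? R i) ¬¬tRi) ¬tTj (decidable-stable (trailing? R j) ¬¬tRj))
      (count-mono (trailing? (complement T)) (trailing? (complement R)) full-R)))
    where
    T : B
    T = splitBlock R D?

    reflexive-R : ∀ i → U T i i → U R i i
    reflexive-R i (inj₁ r) = r
    reflexive-R i (inj₂ (_ , d , ¬d)) = contradiction d ¬d

    full-R : ∀ i → Trailing (complement T) i → Trailing (complement R) i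
    full-R i (j , j<i , ¬¬ij , ¬¬ji) =
      j , j<i , (λ ¬R → ¬¬ij (both-R ¬R (stable T ¬¬ji))) , (λ ¬R → ¬¬ji (both-R ¬R (stable T ¬¬ij)))
      where
      both-R : ∀ {i j} → ¬ U R i j → U T j i → ¬ U T i j
      both-R ¬Rij _ (inj₁ Rij) = ¬Rij Rij
      both-R _ (inj₁ Rji) (inj₂ ((_ , ¬Rji) , _)) = ¬Rji Rji
      both-R _ (inj₂ (_ , _ , ¬di)) (inj₂ (_ , di , _)) = ¬di di

    same-side : ∀ {i j} → Loose R i j → (D i → D j) → (D j → D i) → Loose T i j
    same-side (¬ij , ¬ji) to from =
      (λ { (inj₁ ij) → ¬ij ij ; (inj₂ (_ , di , ¬dj)) → ¬dj (to di) }) ,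
      (λ { (inj₁ ji) → ¬ji ji ; (inj₂ (_ , dj , ¬di)) → ¬di (from dj) })

    Opposite : Fin n → Fin n → Set
    Opposite i j = (D i × ¬ D j) ⊎ (¬ D i × D j)

    opposite : ∀ {i j} → Loose R i j → ¬ Loose T i j → Opposite i j
    opposite {i} {j} l ¬l with D? i | D? j
    ... | yes di | yes dj = contradiction (same-side l (λ _ → dj) (λ _ → di)) ¬l
    ... | yes di | no ¬dj = inj₁ (di , ¬dj)
    ... | no ¬di | yes dj = inj₂ (¬di , dj)
    ... | no ¬di | no ¬dj = contradiction (same-side l (⊥-elim ∘ ¬di) (⊥-elim ∘ ¬dj)) ¬l

    -- An opposite pair contains an element of `D`, which ties it to the one block that is split.
    same-block : ∀ {i i′ j j′} → Loose R i i′ → Opposite i i′ → Loose R j j′ → Opposite j j′ → Loose R i j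
    same-block l (inj₁ (d , _)) m (inj₁ (d′ , _)) = D-loose d d′
    same-block l (inj₁ (d , _)) m (inj₂ (_ , d′)) = loose-trans R (D-loose d d′) (loose-sym R m)
    same-block l (inj₂ (_ , d)) m (inj₁ (d′ , _)) = loose-trans R l (D-loose d d′)
    same-block l (inj₂ (_ , d)) m (inj₂ (_ , d′)) = loose-trans R l (loose-trans R (D-loose d d′) (loose-sym R m))

    -- An element that stops trailing is the least of its half, and its half
    -- does not contain the least element of the block.

    unique : ∀ {i j} → ¬ Trailing T i → Trailing R i → ¬ Trailing T j → Trailing R j → i ≡ j
    unique {i} {j} ¬ti (i′ , i′<i , li) ¬tj (j′ , j′<j , lj) =
      decide (opposite li λ l → ¬ti (i′ , i′<i , l)) (opposite lj λ l → ¬tj (j′ , j′<j , l))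
      where
      aligned : Loose T i j → i ≡ j
      aligned l with Fin.<-cmp i j
      ... | tri< i<j _ _ = contradiction (i , i<j , loose-sym T l) ¬tj
      ... | tri≈ _ i≡j _ = i≡j
      ... | tri> _ _ j<i = contradiction (j , j<i , l) ¬ti

      crossed : Loose T i j′ → Loose T j i′ → i ≡ j
      -- As neither `i` nor `j` trails in `T`, this would give `i ≤ j′ < j ≤ i′ < i`.
      crossed lij′ lji′ = contradiction
        (<-trans (≤-<-trans (≮⇒≥ λ j′<i → ¬ti (j′ , j′<i , lij′)) j′<j)
                 (≤-<-trans (≮⇒≥ λ i′<j → ¬tj (i′ , i′<j , lji′)) i′<i))
        (<-irrefl refl)

      decide : Opposite i i′ → Opposite j j′ → i ≡ j
      decide oi oj with same-block li oi lj oj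
      decide (inj₁ (di , _)) (inj₁ (dj , _)) | l = aligned (same-side l (λ _ → dj) (λ _ → di))
      decide (inj₂ (¬di , _)) (inj₂ (¬dj , _)) | l = aligned (same-side l (⊥-elim ∘ ¬di) (⊥-elim ∘ ¬dj))
      decide (inj₁ (di , ¬di′)) (inj₂ (¬dj , dj′)) | l = crossed
        (same-side (loose-trans R l lj) (λ _ → dj′) (λ _ → di))
        (same-side (loose-trans R (loose-sym R l) li) (⊥-elim ∘ ¬dj) (⊥-elim ∘ ¬di′))
      decide (inj₂ (¬di , di′)) (inj₁ (dj , ¬dj′)) | l = crossed
        (same-side (loose-trans R l lj) (⊥-elim ∘ ¬di) (⊥-elim ∘ ¬dj′))
        (same-side (loose-trans R (loose-sym R l) li) (λ _ → di′) (λ _ → dj))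

  -- The only pair that can be new is `(k , k)`, whereas trailing compares distinct elements; so
  -- only the first count can grow.
  ρ-fillSingleton : (R : B) (k : Fin n) (singleton : ∀ i → Loose R i k → i ≡ k) →
                    ρ (fillSingleton R k (Fin._≟ k) singleton) ≤ suc (ρ R)
  ρ-fillSingleton R k singleton = +-mono-≤
    (count-≤-suc (reflexive? R) (reflexive? T) λ i j Ti ¬Ri Tj ¬Rj →
      trans (new Ti ¬Ri) (sym (new Tj ¬Rj)))
    (+-mono-≤
      (count-mono (leading? T) (leading? R) λ i ¬tT (j , j<i , ¬ij , ¬ji) →
        ¬tT (j , j<i , not-new (<⇒≢ j<i ∘ sym) ¬ij , not-new (<⇒≢ j<i) ¬ji))
      (count-mono (trailing? (complement T)) (trailing? (complement R)) λ i (j , j<i , ¬¬ij , ¬¬ji) →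
        j , j<i , (λ ¬R → ¬¬ij (not-new (<⇒≢ j<i ∘ sym) ¬R)) , (λ ¬R → ¬¬ji (not-new (<⇒≢ j<i) ¬R))))
    where
    T : B
    T = fillSingleton R k (Fin._≟ k) singleton

    new : ∀ {i} → U T i i → ¬ U R i i → i ≡ k
    new (inj₁ r) ¬r = contradiction r ¬r
    new (inj₂ (i≡k , _)) _ = i≡k

    not-new : ∀ {i j} → Fin.toℕ i ≢ Fin.toℕ j → ¬ U R i j → ¬ U T i j
    not-new ≢ ¬r (inj₁ r) = ¬r r
    not-new ≢ ¬r (inj₂ (refl , refl)) = ≢ refl

  -- Interpolation between comparable relations

  Step : B → B → Set₁
  Step R S = ∃[ T ] (U R ⇒ U T × U T ⇒ U S × (∃[ i ] ∃[ j ] (U T i j × ¬ U R i j)) × ρ T ≤ suc (ρ R))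

  split-step : ∀ {R S : B} → U R ⇒ U S → {D : Pred (Fin n) 0ℓ} (D? : Decidable D) →
               (∀ {i j} → D i → D j → Loose R i j) →
               (∀ {i j} → Loose R i j → D i → ¬ D j → U S i j) →
               ∀ {i j} → Loose R i j → D i → ¬ D j → Step R S
  split-step {R} R≤S D? D-loose D-S {i} {j} l di ¬dj =
    splitBlock R D? , inj₁ , (λ { (inj₁ r) → R≤S r ; (inj₂ (l , di , ¬dj)) → D-S l di ¬dj }) ,
    (i , j , inj₂ (l , di , ¬dj) , proj₁ l) , ρ-splitBlock R D? D-loose

  -- The block of `y` is cut along a set that `S` already places before the rest of it, so the cut
  -- stays inside `S`. A singleton block leaves only filling.
  step : ∀ {R S : B} → U R ⇒ U S → ∀ {x y} → Loose R x y → U S x y → Step R S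
  step {R} {S} R≤S {x} {y} lxy Sxy
    with Fin.any? (λ i → loose? R y i ×-dec ¬? (decidable S i y))
  -- The set consists of the block elements that `S` relates to `y`: it contains `x` but not `i`.
  ... | yes (i , lyi , ¬Siy) = split-step {R} {S} R≤S
    (λ j → loose? R y j ×-dec decidable S j y)
    (λ (l , _) (l′ , _) → loose-trans R (loose-sym R l) l′)
    (λ l (lyi , Siy) ¬d → stable S λ ¬Sij →
      transitive-compl S ¬Sij (λ Sjy → ¬d (loose-trans R lyi l , Sjy)) Siy)
    (loose-trans R lxy lyi) (loose-sym R lxy , Sxy) (¬Siy ∘ proj₂)
  ... | no none with Fin.any? (λ i → loose? R y i ×-dec ¬? (decidable S y i))
  -- Now `S` relates the whole block, including `y`, to `y`. The set consists of the block elements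
  -- to which `S` does not relate `y`: it contains `i` but not `y`.
  ... | yes (i , lyi , ¬Syi) = split-step {R} {S} R≤S
    (λ j → loose? R y j ×-dec ¬? (decidable S y j))
    (λ (l , _) (l′ , _) → loose-trans R (loose-sym R l) l′)
    (λ l (lyi , ¬Syi) ¬d → stable S λ ¬Sij →
      ¬d (loose-trans R lyi l , transitive-compl S ¬Syi ¬Sij))
    (loose-sym R lyi) (lyi , ¬Syi)
    λ (lyy , ¬Syy) → none (y , lyy , ¬Syy)
  ... | no none′ with Fin.any? (λ i → loose? R i y ×-dec ¬? (i Fin.≟ y))
  -- Now `S` relates `y` to its whole block in both directions, so `y` can be split off in front.
  ... | yes (i , liy , i≢y) = split-step {R} {S} R≤S
    (Fin._≟ y)
    (λ { refl refl → lyy })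
    (λ { {j = j} lyj refl _ → stable S λ ¬S → none′ (j , lyj , ¬S) })
    (loose-sym R liy) refl i≢y
    where
    lyy : Loose R y y
    lyy = loose-trans R (loose-sym R lxy) lxy
  ... | no only = fillSingleton R y (Fin._≟ y) singleton , inj₁ ,
    (λ { (inj₁ r) → R≤S r
       ; (inj₂ (refl , refl)) → stable S λ ¬Syy → none (y , lyy , ¬Syy) }) ,
    (y , y , inj₂ (refl , refl) , proj₁ lyy) , ρ-fillSingleton R y singleton
    where
    lyy : Loose R y y
    lyy = loose-trans R (loose-sym R lxy) lxy
    singleton : ∀ i → Loose R i y → i ≡ y
    singleton i l = decidable-stable (i Fin.≟ y) λ i≢y → only (i , l , i≢y)

  Between : B → B → Set₁
  Between R S = ∃[ T ] (U R ⇒ U T × ¬ (U T ⇒ U R) × U T ⇒ U S × ¬ (U S ⇒ U T))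

  -- `T` stays strictly below `S` by rank: `ρ T` exceeds `ρ R` by at most one, `ρ S` by at least
  -- two.
  step-between : ∀ {R S : B} → 2 + ρ R ≤ ρ S → Step R S → Between R S
  step-between {R} {S} gap (T , R≤T , T≤S , (i , j , Tij , ¬Rij) , ρT) =
    T , R≤T , (λ T≤R → ¬Rij (T≤R Tij)) , T≤S ,
    λ S≤T → <⇒≱ (≤-<-trans ρT gap) (ρ-mono {S} {T} S≤T)

  between-complement : ∀ {R S : B} → Between (complement S) (complement R) → Between R S
  between-complement {R} {S} (T , S′≤T , ¬T≤S′ , T≤R′ , ¬R′≤T) =
    complement T ,
    (λ r t → T≤R′ t r) ,
    (λ T′≤R → ¬R′≤T λ ¬r → stable T (¬r ∘ T′≤R)) ,
    (λ ¬t → stable S (¬t ∘ S′≤T)) ,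
    (λ S≤T′ → ¬T≤S′ λ t s → S≤T′ s t)

  ρ-complement-gap : ∀ {R S : B} → 2 + ρ R ≤ ρ S → 2 + ρ (complement S) ≤ ρ (complement R)
  ρ-complement-gap {R} {S} gap = +-cancelˡ-≤ (ρ R) _ _ (begin
    ρ R + (2 + ρ (complement S)) ≡⟨ sym (+-assoc (ρ R) 2 _) ⟩
    ρ R + 2 + ρ (complement S)   ≡⟨ cong (_+ ρ (complement S)) (+-comm (ρ R) 2) ⟩
    2 + ρ R + ρ (complement S)   ≤⟨ +-monoˡ-≤ _ gap ⟩
    ρ S + ρ (complement S)       ≡⟨ trans (ρ-complement S) (sym (ρ-complement R)) ⟩
    ρ R + ρ (complement R)       ∎)
    where open ≤-Reasoning

  new-pair : ∀ {R S : B} → ¬ (U S ⇒ U R) → ∃[ x ] ∃[ y ] (U S x y × ¬ U R x y)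
  new-pair {R} {S} S≰R with Fin.any? (λ x → Fin.any? (λ y → decidable S x y ×-dec ¬? (decidable R x y)))
  ... | yes found = found
  ... | no none = contradiction (λ {x} {y} Sxy → stable R λ ¬Rxy → none (x , y , Sxy , ¬Rxy)) S≰R

  -- If `R` relates `y` to `x`, then so does `S`, and `x` and `y` are loose in `complement S`. As
  -- `complement R` relates `x` to `y`, `step` applies to the complements.
  between : ∀ {R S : B} → U R ⇒ U S → ¬ (U S ⇒ U R) → 2 + ρ R ≤ ρ S → Between R S
  between {R} {S} R≤S S≰R gap with new-pair {R} {S} S≰R
  ... | x , y , Sxy , ¬Rxy with decidable R y x
  ... | no ¬Ryx = step-between {R} {S} gap (step {R} {S} R≤S (¬Rxy , ¬Ryx) Sxy)
  ... | yes Ryx = between-complement {R} {S}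
    (step-between {complement S} {complement R} (ρ-complement-gap {R} {S} gap)
      (step {complement S} {complement R} (_∘ R≤S)
        ((λ ¬S → ¬S Sxy) , (λ ¬S → ¬S (R≤S Ryx))) ¬Rxy))

-- Ranks of the empty and the full relation

module _ (m : ℕ) where

  private
    ∅ full : BipartitionalRelation (Fin (suc m))
    ∅ = ∅-rel
    full = full-rel

  -- Everything forms one empty block, whose only leader is `zero`.
  ρ-∅ : ρ ∅ ≡ 1
  ρ-∅ = cong₂ _+_ (count-none (reflexive? ∅) λ _ ())
    (cong₂ _+_
      (count-zero-only (leading? ∅) (λ ())
        λ i ¬t → ¬t (zero , s≤s z≤n , (λ ()) , (λ ())))
      (count-none (trailing? (complement ∅)) λ _ (_ , _ , ¬¬∅ , _) → ¬¬∅ λ ()))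

  suc-ρ-full : suc (ρ full) ≡ 3 * suc m
  suc-ρ-full = begin
    -- `full` and `complement ∅` agree only up to mutual inclusion, hence monotonicity in both
    -- directions.
    1 + ρ full             ≡⟨ cong₂ _+_ (sym ρ-∅) (≤-antisym
                                (ρ-mono {R = full} {complement ∅} λ _ ())
                                (ρ-mono {R = complement ∅} {full} _)) ⟩
    ρ ∅ + ρ (complement ∅) ≡⟨ ρ-complement ∅ ⟩
    3 * suc m              ∎
    where open ≡-Reasoning

  ρ-full : 3 * suc m ∸ 2 + ρ ∅ ≡ ρ full
  ρ-full = begin
    3 * suc m ∸ 2 + ρ ∅ ≡⟨ cong₂ (λ k l → k ∸ 2 + l) (sym suc-ρ-full) ρ-∅ ⟩
    -- `s≤s z≤n` proves `1 ≤ ρ full` by computation, as `zero` is reflexive in `full`.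
    ρ full ∸ 1 + 1      ≡⟨ m∸n+n≡m {ρ full} (s≤s z≤n) ⟩
    ρ full              ∎
    where open ≡-Reasoning

-- Transport along the numbering of `X`

pullback : ∀ {a b} {X : Set a} {Y : Set b} → (Y → X) → BipartitionalRelation X → BipartitionalRelation Y
pullback f R = record
  { U = λ x y → U R (f x) (f y)
  ; decidable = λ x y → decidable R (f x) (f y)
  ; transitive = transitive R
  ; transitive-compl = transitive-compl R
  }

corollary5p3 : {a : Level} (X : Set a) (n : ℕ) → X ↔ Fin n → n ≥ 1 →
    IsGradedOfRank (Bip X) (3 * n ∸ 2)
corollary5p3 X (suc m) X↔Fin _ = isGradedOfRank (3 * suc m ∸ 2) (ρ-full m)
  where
  open Inverse X↔Fin using (to; from; strictlyInverseʳ; strictlyInverseˡ)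
  open PosetProperties (Bip X) using () renaming (_<_ to _⊏_)

  numbered : BipartitionalRelation X → BipartitionalRelation (Fin (suc m))
  numbered = pullback from

  unnumber : ∀ R {x y} → U R (from (to x)) (from (to y)) → U R x y
  unnumber R = subst₂ (U R) (strictlyInverseʳ _) (strictlyInverseʳ _)

  renumber : ∀ R {x y} → U R x y → U R (from (to x)) (from (to y))
  renumber R = subst₂ (U R) (sym (strictlyInverseʳ _)) (sym (strictlyInverseʳ _))

  reflect : ∀ R S → U (numbered R) ⇒ U (numbered S) → U R ⇒ U S
  reflect R S R≤S = unnumber S ∘ R≤S ∘ renumber R

  numbered-strict : ∀ {R S} → R ⊏ S → ¬ (U (numbered S) ⇒ U (numbered R))
  numbered-strict {R} {S} (R≤S , R≉S) S≤R = R≉S (R≤S , reflect S R S≤R)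

  strict : ∀ {R S} → R ⊏ S → ρ (numbered R) < ρ (numbered S)
  strict {R} {S} R⊏S =
    let _ , _ , Sxy , ¬Rxy = new-pair {R = numbered R} {numbered S} (numbered-strict {R} {S} R⊏S)
    in ρ-strict {R = numbered R} {numbered S} (proj₁ R⊏S) Sxy ¬Rxy

  interpolate : ∀ {R S} → R ⊏ S → 2 + ρ (numbered R) ≤ ρ (numbered S) → ∃[ T ] (R ⊏ T × T ⊏ S)
  interpolate {R} {S} R⊏S gap
    with between {R = numbered R} {numbered S} (proj₁ R⊏S) (numbered-strict {R} {S} R⊏S) gap
  -- Pulling `T` back to `X` and numbering it again gives `T` only up to `to (from i) ≡ i`, which
  -- `T⇒` and `T⇐` bridge.
  ... | T , R≤T , T≰R , T≤S , S≰T = pullback to T ,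
    ((R≤T ∘ renumber R) , λ R≈T → T≰R (proj₂ R≈T ∘ T⇒)) ,
    ((unnumber S ∘ T≤S) , λ T≈S → S≰T (T⇐ ∘ proj₂ T≈S))
    where
    T⇒ : ∀ {i j} → U T i j → U T (to (from i)) (to (from j))
    T⇒ = subst₂ (U T) (sym (strictlyInverseˡ _)) (sym (strictlyInverseˡ _))
    T⇐ : ∀ {i j} → U T (to (from i)) (to (from j)) → U T i j
    T⇐ = subst₂ (U T) (strictlyInverseˡ _) (strictlyInverseˡ _)

  open RankFunction (Bip X) (ρ ∘ numbered)
    (λ {R} {S} R≤S → ρ-mono {R = numbered R} {numbered S} R≤S)
    (λ {R} {S} → strict {R} {S}) (λ {R} {S} → interpolate {R} {S})
    ∅-rel full-rel (λ S {x} {y} → ∅-minimum S {x} {y}) (λ S {x} {y} → full-maximum S {x} {y})
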